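{- Let $P$ be a propositional symbol and let $\mathbf{T}$ be the clause set term schema defined by $$\mathbf{T}(0)\equiv[\vdash P(0)]\oplus[P(0)\vdash],\qquad \mathbf{T}(n+1)\equiv\mathbf{T}(n)\otimes\big([\vdash P(n+1)]\oplus[P(n+1)\vdash]\big).$$ Then there is no resolution refutation schema for $\mathbf{T}(n)$ in the class of resolution proof schemata whose recursive definitions have the recursion argument as only parameter (no integer or clause variables); i.e. there is no such resolution proof schema $\rho$ for which, for every $N\in\mathbb{N}$, $\rho\downarrow N$ is a resolution refutation from the clause set $|\mathbf{T}(n)\downarrow N|$.
   Context: Propositional atoms are $P(\alpha)$ with $P$ a propositional symbol and $\alpha\in\mathbb{N}$. A clause is $\Gamma\vdash\Delta$ with $\Gamma,\Delta$ finite lists of atoms. $|[C]|=\{C\}$, $|X\oplus Y|=|X|\cup|Y|$, $|X\otimes Y|=\{C\circ D\mid C\in|X|,D\in|Y|\}$, where $(\Gamma\vdash\Delta)\circ(\Pi\vdash\Lambda)=\Gamma,\Pi\vdash\Delta,\Lambda$. $\mathbf{T}(n)\downarrow N$ is the ground term obtained by setting $n=N$ and unfolding the recursion; its clauses are the $2^{N+1}$ clauses in which each of $P(0),\dots,P(N)$ occurs exactly once, on one side or the other. For clauses $C=\Gamma\vdash\Delta$, $D=\Pi\vdash\Lambda$ and an atom $A$, $\mathrm{res}(C,D;A)=\Gamma,\Pi'\vdash\Delta',\Lambda$ with $\Pi',\Delta'$ obtained from $\Pi,\Delta$ by removing all occurrences of $A$. Resolution deductions from a clause set $\mathcal{C}$: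 each $C\in\mathcal{C}$ (end-clause $C$), and $\mathrm{r}(\gamma_1,\gamma_2;A)$ with end-clause the resolvent with respect to $A$ of the end-clauses of $\gamma_1,\gamma_2$. A resolution refutation is a resolution deduction with end-clause $\vdash$. Arithmetic expressions are $\alpha\times n+\beta$ ($\alpha,\beta\in\mathbb{N}$, $n$ the single parameter); atom schemata are $P(a)$ with $a$ an arithmetic expression; clause schemata are sequents of atom schemata; $\downarrow N$ sets $n=N$. Resolution proof schemata (without integer or clause variables) are built inductively: clause schemata; $\mathrm{r}(\rho_1,\rho_2;A)$ with $\rho_1,\rho_2$ resolution proof schemata and $A$ an atom schema; a variable $X^{\mathrm{res}}$; and $\boldsymbol{\rho}(a)$ with $a$ an arithmetic expression and $\boldsymbol{\rho}$ a symbol defined by a primitive recursive specification $\boldsymbol{\rho}(0)\equiv\rho_{base}$ (a resolution derivation), $\boldsymbol{\rho}(n+1)\equiv\rho_{rec}$ (a resolution proof schema in which $X^{\mathrm{res}}$ may occur and previously defined symbols may occur). Outside specifications, no $X^{\mathrm{res}}$ occurs. Evaluation: $C\downarrow N$ for clause schemata; $\mathrm{r}(\rho_1,\rho_2;A)\downarrow N=\mathrm{r}(\rho_1\downarrow N,\rho_2\downarrow N;A\downarrow N)$; $\boldsymbol{\rho}(a)\downarrow N=\rho_{a\downarrow N}$, where $\rho_0=\rho_{base}$ and $\rho_{\beta+1}=(\rho_{rec}[X^{\mathrm{res}}\mapsto\rho_\beta])\downarrow\beta$. -}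

module Defs where

open import Data.Empty using (⊥; ⊥-elim)
open import Data.Fin using (Fin; zero; suc)
open import Data.List using (List; []; _∷_; _++_; filter; map)
open import Data.Nat using (ℕ; zero; suc; _+_; _*_)
open import Data.Nat.Properties using () renaming (_≟_ to _≟ℕ_)
open import Data.Product using (∃₂; _×_; _,_)
open import Data.Unit using (⊤)
open import Level using (0ℓ)
open import Relation.Binary using (DecidableEquality)
open import Relation.Binary.PropositionalEquality using (_≡_; refl)
open import Relation.Nullary using (¬?)
open import Relation.Nullary.Decidable using (map′; _×-dec_)
open import Relation.Unary using (Pred; _∈_; _∪_; ｛_｝)

infix 4 _⊢_

record Sequent (A : Set) : Set where
  constructor _⊢_
  field
    antecedent : List A
    succedent  : List A

module Resolution (Sym : Set) (_≟_ : DecidableEquality Sym) where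

  infix 8 _at_

  record Atom : Set where
    constructor _at_
    field
      symbol : Sym
      index  : ℕ

  _≟ᴬ_ : DecidableEquality Atom
  (p at α) ≟ᴬ (q at β) =
    map′ (λ { (refl , refl) → refl }) (λ { refl → refl , refl })
         ((p ≟ q) ×-dec (α ≟ℕ β))

  Clause : Set
  Clause = Sequent Atom

  infixl 6 _∘_

  _∘_ : Clause → Clause → Clause
  (Γ ⊢ Δ) ∘ (Π ⊢ Λ) = (Γ ++ Π) ⊢ (Δ ++ Λ)

  ClauseSet : Set₁
  ClauseSet = Pred Clause 0ℓ

  infixl 6 _⊕_
  infixl 7 _⊗_

  data ClauseSetTerm : Set where
    [_]     : Clause → ClauseSetTerm
    _⊕_ _⊗_ : ClauseSetTerm → ClauseSetTerm → ClauseSetTerm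

  ∣_∣ : ClauseSetTerm → ClauseSet
  ∣ [ C ] ∣ = ｛ C ｝
  ∣ X ⊕ Y ∣ = ∣ X ∣ ∪ ∣ Y ∣
  ∣ X ⊗ Y ∣ = λ E → ∃₂ λ C D → C ∈ ∣ X ∣ × D ∈ ∣ Y ∣ × E ≡ C ∘ D

  -- T P N is the ground term T(n)↓N.
  T : Sym → ℕ → ClauseSetTerm
  T P zero    = [ [] ⊢ P at 0 ∷ [] ] ⊕ [ P at 0 ∷ [] ⊢ [] ]
  T P (suc n) = T P n ⊗ ([ [] ⊢ P at suc n ∷ [] ] ⊕ [ P at suc n ∷ [] ⊢ [] ])

  _without_ : List Atom → Atom → List Atom
  Γ without A = filter (λ B → ¬? (B ≟ᴬ A)) Γ

  -- The resolved atom need not occur in Δ or in Π.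
  res : Clause → Clause → Atom → Clause
  res (Γ ⊢ Δ) (Π ⊢ Λ) A = (Γ ++ (Π without A)) ⊢ ((Δ without A) ++ Λ)

  data Deduction : Set where
    clause : Clause → Deduction
    r      : Deduction → Deduction → Atom → Deduction

  endClause : Deduction → Clause
  endClause (clause C)  = C
  endClause (r γ₁ γ₂ A) = res (endClause γ₁) (endClause γ₂) A

  data _IsDeductionFrom_ : Deduction → ClauseSet → Set₁ where
    clause : ∀ {𝒞 C} → C ∈ 𝒞 → clause C IsDeductionFrom 𝒞
    r      : ∀ {𝒞 γ₁ γ₂} → γ₁ IsDeductionFrom 𝒞 → γ₂ IsDeductionFrom 𝒞 →
             ∀ A → r γ₁ γ₂ A IsDeductionFrom 𝒞

  _IsRefutationFrom_ : Deduction → ClauseSet → Set₁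
  γ IsRefutationFrom 𝒞 = γ IsDeductionFrom 𝒞 × endClause γ ≡ ([] ⊢ [])

  infix 7 _×n+_

  record ArithExpr : Set where
    constructor _×n+_
    field
      coefficient : ℕ
      constant    : ℕ

  _↓ᵉ_ : ArithExpr → ℕ → ℕ
  (α ×n+ β) ↓ᵉ N = α * N + β

  record AtomSchema : Set where
    constructor _at_
    field
      symbol : Sym
      index  : ArithExpr

  _↓ᵃ_ : AtomSchema → ℕ → Atom
  (p at a) ↓ᵃ N = p at (a ↓ᵉ N)

  ClauseSchema : Set
  ClauseSchema = Sequent AtomSchema

  _↓ᶜ_ : ClauseSchema → ℕ → Clause
  (Γ ⊢ Δ) ↓ᶜ N = map (_↓ᵃ N) Γ ⊢ map (_↓ᵃ N) Δ

  -- Schemata over k already specified proof symbols, with variables from V: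
  -- V = ⊤ (the single variable X^res) inside a recursive specification,
  -- V = ⊥ outside.
  data Schema (k : ℕ) (V : Set) : Set where
    clause : ClauseSchema → Schema k V
    r      : Schema k V → Schema k V → AtomSchema → Schema k V
    var    : V → Schema k V
    call   : Fin k → ArithExpr → Schema k V

  record Specification (k : ℕ) : Set where
    field
      base : Deduction
      rec  : Schema k ⊤

  infixl 5 _▷_

  -- Each specification refers only to symbols specified before it;
  -- the most recently specified symbol is zero.
  data Specifications : ℕ → Set where
    []  : Specifications 0
    _▷_ : ∀ {k} → Specifications k → Specification k → Specifications (suc k)

  open Specification

  -- `eval Ξ ρ σ N` is ρ[σ]↓N: the substituted deductions are ground, hence
  -- unaffected by setting n = N, so substitution and evaluation are done at
  -- once.  `unfold Ξ i β` is the deduction ρ_β of the i-th symbol.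
  eval   : ∀ {k V} → Specifications k → Schema k V → (V → Deduction) → ℕ → Deduction
  unfold : ∀ {k} → Specifications k → Fin k → ℕ → Deduction

  eval Ξ (clause C)  σ N = clause (C ↓ᶜ N)
  eval Ξ (r ρ₁ ρ₂ A) σ N = r (eval Ξ ρ₁ σ N) (eval Ξ ρ₂ σ N) (A ↓ᵃ N)
  eval Ξ (var X)     σ N = σ X
  eval Ξ (call i a)  σ N = unfold Ξ i (a ↓ᵉ N)

  unfold (Ξ ▷ s) zero    zero    = base s
  unfold (Ξ ▷ s) zero    (suc β) = eval Ξ (rec s) (λ _ → unfold (Ξ ▷ s) zero β) β
  unfold (Ξ ▷ s) (suc i) β       = unfold Ξ i β

  record ProofSchema : Set where
    field
      {size}         : ℕ
      specifications : Specifications size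
      schema         : Schema size ⊥

  _↓_ : ProofSchema → ℕ → Deduction
  ρ ↓ N = eval (ProofSchema.specifications ρ) (ProofSchema.schema ρ) ⊥-elim N

  _IsRefutationSchemaFor_ : ProofSchema → (ℕ → ClauseSetTerm) → Set₁
  ρ IsRefutationSchemaFor t = ∀ N → (ρ ↓ N) IsRefutationFrom ∣ t N ∣

{-# OPTIONS --safe #-}
-- A clause schema has as many atoms as each of its instances, and unfolding a
-- recursion creates no new clause schemata.  So the leaves of ρ ↓ N have a size
-- bounded independently of N, whereas the clauses of T(n)↓N have N + 1 atoms.
-- The leftmost leaf alone already gives the contradiction.
module Submission where

open import Data.Empty using (⊥-elim)
open import Data.Fin using (Fin; zero; suc)
open import Data.List using ([]; _∷_; length)
open import Data.List.Properties using (length-++; length-map)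
open import Data.Nat using (ℕ; zero; suc; _+_; _≤_; _⊔_)
open import Data.Nat.Properties
  using (+-comm; +-commutativeSemigroup; ≤-refl; ≤-trans;
         ≤-reflexive; m≤m⊔n; m≤n⊔m; 1+n≰n)
open import Algebra.Properties.CommutativeSemigroup +-commutativeSemigroup
  using (interchange)
open import Data.Product using (∃; _,_; proj₁; proj₂)
open import Data.Sum using (inj₁; inj₂)
open import Relation.Binary using (DecidableEquality)
open import Relation.Binary.PropositionalEquality
  using (_≡_; refl; trans; cong; cong₂; subst)
open import Relation.Nullary using (¬_)
open import Relation.Unary using (_∈_)
open import Defs

size : {A : Set} → Sequent A → ℕ
size (Γ ⊢ Δ) = length Γ + length Δ

module LeafSize (Sym : Set) (_≟_ : DecidableEquality Sym) where

  open Resolution Sym _≟_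

  size-∘ : ∀ C D → size (C ∘ D) ≡ size C + size D
  size-∘ (Γ ⊢ Δ) (Π ⊢ Λ) =
    trans (cong₂ _+_ (length-++ Γ) (length-++ Δ))
          (interchange (length Γ) (length Π) (length Δ) (length Λ))

  size-↓ᶜ : ∀ C N → size (C ↓ᶜ N) ≡ size C
  size-↓ᶜ (Γ ⊢ Δ) N = cong₂ _+_ (length-map _ Γ) (length-map _ Δ)

  -- Both clauses of the `⊕` factor are unit clauses and `size` is additive under `∘`, so each level
  -- adds exactly one atom.
  ∈T⇒size : ∀ P N {C} → C ∈ ∣ T P N ∣ → size C ≡ suc N
  ∈T⇒size P zero (inj₁ refl) = refl
  ∈T⇒size P zero (inj₂ refl) = refl
  ∈T⇒size P (suc N) (C , D , C∈ , D∈ , refl) =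
    trans (size-∘ C D)
          (trans (cong₂ _+_ (∈T⇒size P N C∈) (size-D D∈)) (+-comm (suc N) 1))
    where
    size-D : ∀ {D} →
      D ∈ ∣ [ [] ⊢ P at suc N ∷ [] ] ⊕ [ P at suc N ∷ [] ⊢ [] ] ∣ → size D ≡ 1
    size-D (inj₁ refl) = refl
    size-D (inj₂ refl) = refl

  leftmostLeaf : Deduction → Clause
  leftmostLeaf (clause C) = C
  leftmostLeaf (r γ₁ _ _) = leftmostLeaf γ₁

  leftmostLeaf-∈ : ∀ {γ 𝒞} → γ IsDeductionFrom 𝒞 → leftmostLeaf γ ∈ 𝒞
  leftmostLeaf-∈ (clause C∈) = C∈
  leftmostLeaf-∈ (r d₁ _ _)  = leftmostLeaf-∈ d₁

  leafSize : Deduction → ℕ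
  leafSize γ = size (leftmostLeaf γ)

  -- Quantifying over all B above the bound b makes the estimate for X^res
  -- self-reproducing along the recursion: the step returns the same B.
  eval-bounded : ∀ {k V} (Ξ : Specifications k) (ρ : Schema k V) →
    ∃ λ b → ∀ {B σ} → b ≤ B → (∀ X → leafSize (σ X) ≤ B) →
            ∀ N → leafSize (eval Ξ ρ σ N) ≤ B
  -- Uniformity in `β` is the point. The mutual recursion terminates because a specification calls
  -- only symbols of the shorter list `Ξ`.
  unfold-bounded : ∀ {k} (Ξ : Specifications k) (i : Fin k) →
    ∃ λ b → ∀ β → leafSize (unfold Ξ i β) ≤ b

  eval-bounded Ξ (clause C) =
    size C , λ b≤B _ N → ≤-trans (≤-reflexive (size-↓ᶜ C N)) b≤B
  eval-bounded Ξ (r ρ₁ _ _) = eval-bounded Ξ ρ₁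
  -- A variable creates no leaf of its own, so the hypothesis on `σ` already suffices.
  eval-bounded Ξ (var X)    = 0 , λ _ σ≤B _ → σ≤B X
  eval-bounded Ξ (call i a) =
    let b , unfold≤b = unfold-bounded Ξ i
    in b , λ b≤B _ N → ≤-trans (unfold≤b (a ↓ᵉ N)) b≤B

  unfold-bounded (Ξ ▷ s) (suc i) = unfold-bounded Ξ i
  unfold-bounded (Ξ ▷ s) zero    = B , bounded
    where
    base-size = leafSize (Specification.base s)
    rec-bound = eval-bounded Ξ (Specification.rec s)
    -- The first argument starts the induction on `β`; the second makes `B` admissible in
    -- `rec-bound`, with the induction hypothesis covering the recursion variable.
    B = base-size ⊔ proj₁ rec-bound

    bounded : ∀ β → leafSize (unfold (Ξ ▷ s) zero β) ≤ B
    bounded zero    = m≤m⊔n base-size (proj₁ rec-bound)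
    bounded (suc β) =
      proj₂ rec-bound (m≤n⊔m base-size (proj₁ rec-bound)) (λ _ → bounded β) β

mainTheorem4 : (Sym : Set) (_≟_ : DecidableEquality Sym) (P : Sym) →
    let open Resolution Sym _≟_ in
    ¬ (∃ λ (ρ : ProofSchema) → ρ IsRefutationSchemaFor (T P))
mainTheorem4 Sym _≟_ P (ρ , refutes) =
  let b , eval≤b = eval-bounded (ProofSchema.specifications ρ) (ProofSchema.schema ρ)
      -- Taking `b` itself as the parameter forces a leaf with `suc b` atoms.
      leaf∈T     = leftmostLeaf-∈ (proj₁ (refutes b))
  in 1+n≰n (subst (_≤ b) (∈T⇒size P b leaf∈T) (eval≤b {σ = ⊥-elim} ≤-refl (λ ()) b))
  where
  open Resolution Sym _≟_
  open LeafSize Sym _≟_
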